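{- Let $\mathsf{cvp}$ be any conjunctive variable projection for quantifier-free linear integer arithmetic (with divisibility predicates). Define $\mathsf{tp}$ on transitions $\tau$ and models $\sigma\models\tau$ as follows. Let $x_\delta$ ($x\in\vec x$) be fresh variables, $\tau_{\land\delta}:=\tau\land\bigwedge_{x\in\vec x}x_\delta\doteq x'-x$, $\tau_\delta:=\mathsf{cvp}(\tau_{\land\delta},\ \sigma\uplus[x_\delta/\sigma(x'-x)\mid x\in\vec x],\ \{x_\delta\mid x\in\vec x\})$, and $\tau_{\mathsf{rec}}:=\tau_\delta[x_\delta/x'-x\mid x\in\vec x]$, whose literals are written in the form $t\bowtie0$ with $\bowtie\in\{\le,\ge,<,>,\doteq\}$ or $e\mid t$ with $e\in\mathbb{N}_+$, where $t=\sum_{x\in\vec x}c_x(x'-x)+c$ with $c_x,c\in\mathbb{Z}$. Let $n$ be a fresh variable. Then $\mathsf{tp}(\tau,\sigma)$ is the conjunction of: $n>0$; for each literal $\sum_{x}c_x(x'-x)+c\bowtie0$ of $\tau_{\mathsf{rec}}$, the literal $\sum_x c_x(x'-x)+n\cdot c\bowtie0$; for each literal $e\mid\sum_x c_x(x'-x)+c$ of $\tau_{\mathsf{rec}}$, the literal $e\mid\sum_x c_x(x'-x)+n\cdot c$; and the formulas $\mathsf{cvp}(\tau,\sigma,\vec x)$ and $\mathsf{cvp}(\tau,\sigma,\vec x')$. Then $\mathsf{tp}$ is a transitive projection.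
   Context: The theory is quantifier-free linear integer arithmetic over $\mathbb{Z}$, including divisibility literals $e\mid t$ ($e\in\mathbb{N}_+$, $t$ an integer linear term), with $\sigma\models e\mid t$ iff $\sigma(t)$ is a multiple of $e$. Fix disjoint vectors $\vec x=(x_1,\dots,x_d)$ (pre-variables) and $\vec x'=(x'_1,\dots,x'_d)$ (post-variables); other variables are extra variables. A formula $\tau$ induces a relation $\to_\tau$ on $\mathbb{Z}^d$: $\vec v\to_\tau\vec v'$ iff $\tau[\vec x/\vec v,\vec x'/\vec v']$ is satisfiable. A transition is a conjunction of literals with variables among $\vec x\cup\vec x'$. A valuation is a partial map from variables to $\mathbb{Z}$; $\sigma\models\psi$ means all variables of $\psi$ are in $\mathrm{dom}(\sigma)$ and $\sigma(\psi)$ is true; $\psi$ is consistent with $\sigma$ if $\sigma(\psi)$ is satisfiable. A conjunctive variable projection is a function $\mathsf{cvp}(\tau,\sigma,X)$ (formula, valuation, variable set) such that for all quantifier-free $\tau$, $X$ and $\sigma\models\tau$: (1) $\sigma\models\mathsf{cvp}(\tau,\sigma,X)$; (2) $\mathsf{cvp}(\tau,\sigma,X)\models\tau$; (3) $\{\mathsf{cvp}(\tau,\theta,X)\mid\theta\models\tau\}$ is finite; (4) the variables of $\mathsf{cvp}(\tau,\sigma,X)$ lie in $X\cap\mathcal V(\tau)$; (5) $\mathsf{cvp}(\tau,\sigma,X)$ is a conjunction of literals. A transitive projection is a function $\mathsf{tp}$ mapping (formula, valuation) to a quantifier-free formula such that for every transition $\tau$ and every $\sigma\models\tau$: (1) $\mathsf{tp}(\tau,\sigma)$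 is consistent with $\sigma$; (2) $\{\mathsf{tp}(\tau,\theta)\mid\theta\models\tau\}$ is finite; (3) the relation $\to_{\mathsf{tp}(\tau,\sigma)}$ is transitive.
   Formalization: Consistency of tp(τ,σ) with σ is claimed only when σ does not assign the fresh variable n (it fails if σ(n) = -1); where σ(x'-x) is undefined because σ omits x or x', the missing value is taken as 0; condition (2) of cvp is read with variables outside X existentially quantified. -}

module Defs where

open import Data.Bool.Base using (Bool; true; false; if_then_else_; T)
open import Data.Fin.Base using (Fin)
open import Data.Fin.Properties using (any?)
open import Data.Integer.Base as ℤ using (ℤ; +_; 0ℤ; 1ℤ; -1ℤ)
open import Data.Integer.Divisibility.Signed as ℤ∣ using ()
open import Data.List.Base using (List; []; _∷_; _++_; map; foldr; allFin)
open import Data.List.Membership.Propositional using (_∈_)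
open import Data.Maybe.Base using (Maybe; just; nothing; maybe; fromMaybe)
open import Data.Nat.Base as ℕ using (ℕ; NonZero)
import Data.Nat.Properties as ℕₚ
open import Data.Product.Base using (∃; ∃-syntax; _×_; _,_; proj₂)
open import Data.Sum.Base using (_⊎_)
open import Data.Unit.Base using (⊤)
open import Data.Vec.Base using (Vec; lookup)
open import Relation.Binary.Core using (Rel)
open import Relation.Binary.Definitions using (Transitive)
open import Relation.Binary.PropositionalEquality using (_≡_)
open import Relation.Nullary using (¬_; Dec; yes; no; does)
open import Level using (0ℓ)

private
  variable
    d : ℕ

data Var (d : ℕ) : Set where
  pre post : Fin d → Var d
  extra    : ℕ → Var d

VarSet : ℕ → Set
VarSet d = Var d → Bool

preVars postVars : VarSet d
preVars (pre _) = true
preVars _       = false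
postVars (post _) = true
postVars _        = false

-- lin ((a₁ , v₁) ∷ … ∷ (aₖ , vₖ) ∷ []) c  stands for  a₁v₁ + … + aₖvₖ + c.
record Term (d : ℕ) : Set where
  constructor lin
  field
    coeffs   : List (ℤ × Var d)
    constant : ℤ

con : ℤ → Term d
con c = lin [] c

var : Var d → Term d
var v = lin ((1ℤ , v) ∷ []) 0ℤ

infixl 6 _⊕_ _⊖_
infixl 7 _⊙_

_⊕_ : Term d → Term d → Term d
lin as a ⊕ lin bs b = lin (as ++ bs) (a ℤ.+ b)

_⊙_ : ℤ → Term d → Term d
k ⊙ lin as a = lin (map (λ (b , v) → (k ℤ.* b , v)) as) (k ℤ.* a)

_⊖_ : Term d → Term d → Term d
s ⊖ t = s ⊕ (-1ℤ ⊙ t)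

data Cmp : Set where
  le ge lt gt eq : Cmp

-- cmp ⋈ t  is  t ⋈ 0;  dvd e t  is  e ∣ t.
data Literal (d : ℕ) : Set where
  cmp : Cmp → Term d → Literal d
  dvd : (e : ℕ) .{{_ : NonZero e}} → Term d → Literal d

infixr 6 _∧ᶠ_
infixr 5 _∨ᶠ_

data Formula (d : ℕ) : Set where
  lit       : Literal d → Formula d
  ⊤ᶠ        : Formula d
  _∧ᶠ_ _∨ᶠ_ : Formula d → Formula d → Formula d
  ¬ᶠ_       : Formula d → Formula d

⋀ : List (Formula d) → Formula d
⋀ = foldr _∧ᶠ_ ⊤ᶠ

_≐_ : Term d → Term d → Formula d
s ≐ t = lit (cmp eq (s ⊖ t))

data IsConjunction {d : ℕ} : Formula d → Set where
  lit  : ∀ l → IsConjunction (lit l)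
  ⊤ᶠ   : IsConjunction ⊤ᶠ
  _∧ᶠ_ : ∀ {φ ψ} → IsConjunction φ → IsConjunction ψ → IsConjunction (φ ∧ᶠ ψ)

varsᵗ : Term d → List (Var d)
varsᵗ t = map proj₂ (Term.coeffs t)

vars : Formula d → List (Var d)
vars (lit (cmp _ t)) = varsᵗ t
vars (lit (dvd _ t)) = varsᵗ t
vars ⊤ᶠ              = []
vars (φ ∧ᶠ ψ)        = vars φ ++ vars ψ
vars (φ ∨ᶠ ψ)        = vars φ ++ vars ψ
vars (¬ᶠ φ)          = vars φ

mapTerms : (Term d → Term d) → Formula d → Formula d
mapTerms f (lit (cmp r t)) = lit (cmp r (f t))
mapTerms f (lit (dvd e t)) = lit (dvd e (f t))
mapTerms f ⊤ᶠ              = ⊤ᶠ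
mapTerms f (φ ∧ᶠ ψ)        = mapTerms f φ ∧ᶠ mapTerms f ψ
mapTerms f (φ ∨ᶠ ψ)        = mapTerms f φ ∨ᶠ mapTerms f ψ
mapTerms f (¬ᶠ φ)          = ¬ᶠ mapTerms f φ

substᵗ : (Var d → Term d) → Term d → Term d
substᵗ s (lin as c) = foldr (λ (a , v) t → a ⊙ s v ⊕ t) (con c) as

substᶠ : (Var d → Term d) → Formula d → Formula d
substᶠ s = mapTerms (substᵗ s)

evalᵗ : (Var d → ℤ) → Term d → ℤ
evalᵗ ρ (lin as c) = foldr (λ (a , v) z → a ℤ.* ρ v ℤ.+ z) c as

⟦_⟧ᶜ : Cmp → ℤ → Set
⟦ le ⟧ᶜ z = z ℤ.≤ 0ℤ
⟦ ge ⟧ᶜ z = z ℤ.≥ 0ℤ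
⟦ lt ⟧ᶜ z = z ℤ.< 0ℤ
⟦ gt ⟧ᶜ z = z ℤ.> 0ℤ
⟦ eq ⟧ᶜ z = z ≡ 0ℤ

Holds : (Var d → ℤ) → Formula d → Set
Holds ρ (lit (cmp r t)) = ⟦ r ⟧ᶜ (evalᵗ ρ t)
Holds ρ (lit (dvd e t)) = (+ e) ℤ∣.∣ evalᵗ ρ t
Holds ρ ⊤ᶠ              = ⊤
Holds ρ (φ ∧ᶠ ψ)        = Holds ρ φ × Holds ρ ψ
Holds ρ (φ ∨ᶠ ψ)        = Holds ρ φ ⊎ Holds ρ ψ
Holds ρ (¬ᶠ φ)          = ¬ Holds ρ φ

Valuation : ℕ → Set
Valuation d = Var d → Maybe ℤ

_∈dom_ : Var d → Valuation d → Set
v ∈dom σ = ∃[ z ] σ v ≡ just z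

total : Valuation d → Var d → ℤ
total σ v = fromMaybe 0ℤ (σ v)

infix 4 _⊨_

-- The default 0 in total is never consulted here: all variables of ψ are in dom σ.
_⊨_ : Valuation d → Formula d → Set
σ ⊨ ψ = (∀ {v} → v ∈ vars ψ → v ∈dom σ) × Holds (total σ) ψ

Satisfiable : Formula d → Set
Satisfiable ψ = ∃[ θ ] θ ⊨ ψ

apply : Valuation d → Formula d → Formula d
apply σ = substᶠ (λ v → maybe con (var v) (σ v))

Consistent : Valuation d → Formula d → Set
Consistent σ ψ = Satisfiable (apply σ ψ)

restrict : Valuation d → VarSet d → Valuation d
restrict σ X v = if X v then σ v else nothing

[_,_] : Vec ℤ d → Vec ℤ d → Valuation d
[ v , v′ ] (pre i)   = just (lookup v i)
[ v , v′ ] (post i)  = just (lookup v′ i)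
[ v , v′ ] (extra _) = nothing

Step : Formula d → Rel (Vec ℤ d) 0ℓ
Step τ v v′ = Satisfiable (apply [ v , v′ ] τ)

IsTransition : Formula d → Set
IsTransition {d} τ = IsConjunction τ × (∀ k → ¬ (extra k ∈ vars τ))

-- {f θ ∣ θ ⊨ τ} is contained in a finite list.
FiniteImage : (Valuation d → Formula d) → Formula d → Set
FiniteImage f τ = ∃[ ψs ] (∀ θ → θ ⊨ τ → f θ ∈ ψs)

record IsCVP (cvp : Formula d → Valuation d → VarSet d → Formula d) : Set where
  field
    model : ∀ τ σ X → σ ⊨ τ → σ ⊨ cvp τ σ X
    -- The variables of τ outside X are projected away, so the entailment
    -- cvp τ σ X ⊨ τ has them existentially quantified: a model of the
    -- projection, restricted to X, can be completed to a model of τ.  Without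
    -- the restriction no projection would exist at all.
    entails : ∀ τ σ X → σ ⊨ τ → ∀ θ → θ ⊨ cvp τ σ X → Consistent (restrict θ X) τ
    finite : ∀ τ σ X → σ ⊨ τ → FiniteImage (λ θ → cvp τ θ X) τ
    variables : ∀ τ σ X → σ ⊨ τ → ∀ {v} → v ∈ vars (cvp τ σ X) → T (X v) × v ∈ vars τ
    conjunction : ∀ τ σ X → σ ⊨ τ → IsConjunction (cvp τ σ X)

record IsTransitiveProjection (tp : Formula d → Valuation d → Formula d) : Set where
  field
    -- The extra variables of tp τ σ are meant to be fresh, hence unassigned by
    -- σ.  A valuation that happens to assign them (say n ↦ -1 for a conjunct
    -- n > 0) could not be consistent with tp τ σ.
    consistent : ∀ τ → IsTransition τ → ∀ σ → σ ⊨ τ →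
                 (∀ k → extra k ∈ vars (tp τ σ) → σ (extra k) ≡ nothing) →
                 Consistent σ (tp τ σ)
    finite     : ∀ τ → IsTransition τ → ∀ σ → σ ⊨ τ → FiniteImage (tp τ) τ
    transitive : ∀ τ → IsTransition τ → ∀ σ → σ ⊨ τ → Transitive (Step (tp τ σ))

module Construction
  (cvp : Formula d → Valuation d → VarSet d → Formula d)
  (δ : Fin d → ℕ)   -- xᵢ has the difference variable extra (δ i)
  (n : ℕ)
  where

  isδ? : ∀ k → Dec (∃[ i ] δ i ≡ k)
  isδ? k = any? (λ i → δ i ℕₚ.≟ k)

  δVars : VarSet d
  δVars (extra k) = does (isδ? k)
  δVars _         = false

  diff : Fin d → Term d
  diff i = var (post i) ⊖ var (pre i)

  τ∧δ : Formula d → Formula d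
  τ∧δ τ = τ ∧ᶠ ⋀ (map (λ i → var (extra (δ i)) ≐ diff i) (allFin d))

  -- σ ⊎ [xδ / σ(x′ - x)].  A model of τ need not assign pre- and post-variables
  -- that do not occur in τ, in which case σ(x′ - x) is undefined; such variables
  -- are assigned 0.
  extend : Valuation d → Valuation d
  extend σ (pre i)  = just (total σ (pre i))
  extend σ (post i) = just (total σ (post i))
  extend σ (extra k) with isδ? k
  ... | yes (i , _) = just (evalᵗ (total σ) (diff i))
  ... | no _        = σ (extra k)

  τδ : Formula d → Valuation d → Formula d
  τδ τ σ = cvp (τ∧δ τ) (extend σ) δVars

  δ↦diff : Var d → Term d
  δ↦diff (extra k) with isδ? k
  ... | yes (i , _) = diff i
  ... | no _        = var (extra k)
  δ↦diff v = var v

  τrec : Formula d → Valuation d → Formula d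
  τrec τ σ = substᶠ δ↦diff (τδ τ σ)

  -- Σ cₓ(x′ - x) + c  becomes  Σ cₓ(x′ - x) + n·c.
  scaleConstant : Term d → Term d
  scaleConstant (lin as c) = lin (as ++ (c , extra n) ∷ []) 0ℤ

  tp : Formula d → Valuation d → Formula d
  tp τ σ =
       lit (cmp gt (var (extra n)))
    ∧ᶠ mapTerms scaleConstant (τrec τ σ)
    ∧ᶠ cvp τ σ preVars
    ∧ᶠ cvp τ σ postVars

{-# OPTIONS --safe #-}
module Submission where

-- The terms of τrec are affine in the differences x′ - x, and these add up along
-- a composition of two steps.  Multiplying the constant by n makes every literal
-- homogeneous in (x′ - x, n), so its truth set is closed under addition, and two
-- steps with counters n₁ and n₂ compose to one with counter n₁ + n₂; cvp τ σ preVars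
-- is inherited from the first step and cvp τ σ postVars from the second.
-- The counter value n = 1 turns tp back into τrec, which gives consistency.

open import Data.Nat.Base using (ℕ)
open import Data.Fin.Base using (Fin)
open import Function.Definitions using (Injective)
open import Relation.Binary.PropositionalEquality using (_≡_; _≢_)
open import Defs

open import Data.Bool.Base using (T)
open import Data.Empty using (⊥-elim)
open import Data.Integer.Base using (ℤ; _+_; _*_; 0ℤ; 1ℤ; -1ℤ; +<+)
open import Data.Integer.Divisibility.Signed using (_∣_; ∣m∣n⇒∣m+n)
import Data.Integer.Properties as ℤₚ
open import Data.Integer.Tactic.RingSolver using (solve-∀)
open import Data.List.Base using ([]; _∷_; map; allFin)
open import Data.List.Membership.Propositional using (_∈_)
open import Data.List.Membership.Propositional.Properties
  using (∈-++⁺ˡ; ∈-++⁺ʳ; ∈-++⁻; ∈-cartesianProductWith⁺)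
open import Data.List.Relation.Unary.All using (All; []; _∷_)
import Data.List.Relation.Unary.All.Properties as Allₚ
open import Data.List.Relation.Unary.Any using (here; there)
open import Data.Maybe.Base using (just; nothing; maybe; fromMaybe)
open import Data.Nat.Base using (s≤s; z≤n)
open import Data.Product.Base using (_,_; proj₁; proj₂; ∃-syntax)
import Data.Product.Base as Product
open import Data.Sum.Base using ([_,_]′)
import Data.Sum.Base as Sum
open import Data.Unit.Base using (tt)
open import Data.Vec.Base using (lookup)
open import Function.Base using (_∘_)
open import Function.Bundles using (_⇔_; mk⇔; Equivalence)
open import Relation.Binary.Definitions using (Transitive)
open import Relation.Binary.PropositionalEquality
  using (refl; sym; trans; cong; cong₂; subst; module ≡-Reasoning)
open import Relation.Nullary using (yes; no)

open Equivalence using (to; from)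

private
  variable
    d : ℕ

-- Evaluation of linear terms and formulas under substitution.

evalᵗ-⊕ : ∀ (ρ : Var d → ℤ) s t → evalᵗ ρ (s ⊕ t) ≡ evalᵗ ρ s + evalᵗ ρ t
evalᵗ-⊕ ρ (lin [] a) (lin [] b) = refl
evalᵗ-⊕ ρ (lin [] a) (lin ((k , v) ∷ bs) b) =
  trans (cong (k * ρ v +_) (evalᵗ-⊕ ρ (lin [] a) (lin bs b)))
        (rearrange (k * ρ v) a (evalᵗ ρ (lin bs b)))
  where
  rearrange : ∀ x y z → x + (y + z) ≡ y + (x + z)
  rearrange = solve-∀
evalᵗ-⊕ ρ (lin ((k , v) ∷ as) a) t =
  trans (cong (k * ρ v +_) (evalᵗ-⊕ ρ (lin as a) t))
        (sym (ℤₚ.+-assoc (k * ρ v) _ _))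

evalᵗ-⊙ : ∀ (ρ : Var d → ℤ) k t → evalᵗ ρ (k ⊙ t) ≡ k * evalᵗ ρ t
evalᵗ-⊙ ρ k (lin [] a) = refl
evalᵗ-⊙ ρ k (lin ((b , v) ∷ as) a) =
  trans (cong (k * b * ρ v +_) (evalᵗ-⊙ ρ k (lin as a)))
        (factor k b (ρ v) (evalᵗ ρ (lin as a)))
  where
  factor : ∀ k b x y → k * b * x + k * y ≡ k * (b * x + y)
  factor = solve-∀

evalᵗ-var : ∀ (ρ : Var d → ℤ) v → evalᵗ ρ (var v) ≡ ρ v
evalᵗ-var ρ v = trans (ℤₚ.+-identityʳ _) (ℤₚ.*-identityˡ (ρ v))

evalᵗ-subst : ∀ (ρ ρ′ : Var d → ℤ) s t →
              (∀ {v} → v ∈ varsᵗ t → evalᵗ ρ (s v) ≡ ρ′ v) →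
              evalᵗ ρ (substᵗ s t) ≡ evalᵗ ρ′ t
evalᵗ-subst _ _ _ (lin [] c) h = refl
evalᵗ-subst ρ ρ′ s (lin ((a , v) ∷ as) c) h =
  trans (evalᵗ-⊕ ρ (a ⊙ s v) (substᵗ s (lin as c)))
        (cong₂ _+_ (trans (evalᵗ-⊙ ρ a (s v)) (cong (a *_) (h (here refl))))
                   (evalᵗ-subst ρ ρ′ s (lin as c) (h ∘ there)))

-- Negation reverses implications, hence the equivalence. The premise covers every term over the
-- variables of `φ`, so facts known only about these variables suffice to discharge it.
Holds-mapTerms : ∀ (ρ ρ′ : Var d → ℤ) f φ →
                 (∀ t → (∀ {v} → v ∈ varsᵗ t → v ∈ vars φ) → evalᵗ ρ (f t) ≡ evalᵗ ρ′ t) →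
                 Holds ρ (mapTerms f φ) ⇔ Holds ρ′ φ
Holds-mapTerms _ _ _ (lit (cmp r t)) h =
  mk⇔ (subst ⟦ r ⟧ᶜ (h t λ p → p)) (subst ⟦ r ⟧ᶜ (sym (h t λ p → p)))
Holds-mapTerms _ _ _ (lit (dvd e t)) h =
  mk⇔ (subst (_ ∣_) (h t λ p → p)) (subst (_ ∣_) (sym (h t λ p → p)))
Holds-mapTerms _ _ _ ⊤ᶠ h = mk⇔ _ _
Holds-mapTerms ρ ρ′ f (φ ∧ᶠ ψ) h = mk⇔ (Product.map (to l) (to r)) (Product.map (from l) (from r))
  where
  l = Holds-mapTerms ρ ρ′ f φ λ t p → h t (∈-++⁺ˡ ∘ p)
  r = Holds-mapTerms ρ ρ′ f ψ λ t p → h t (∈-++⁺ʳ (vars φ) ∘ p)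
Holds-mapTerms ρ ρ′ f (φ ∨ᶠ ψ) h = mk⇔ (Sum.map (to l) (to r)) (Sum.map (from l) (from r))
  where
  l = Holds-mapTerms ρ ρ′ f φ λ t p → h t (∈-++⁺ˡ ∘ p)
  r = Holds-mapTerms ρ ρ′ f ψ λ t p → h t (∈-++⁺ʳ (vars φ) ∘ p)
Holds-mapTerms ρ ρ′ f (¬ᶠ φ) h = mk⇔ (_∘ from i) (_∘ to i)
  where i = Holds-mapTerms ρ ρ′ f φ h

Holds-subst : ∀ (ρ ρ′ : Var d → ℤ) s φ →
              (∀ {v} → v ∈ vars φ → evalᵗ ρ (s v) ≡ ρ′ v) →
              Holds ρ (substᶠ s φ) ⇔ Holds ρ′ φ
Holds-subst ρ ρ′ s φ h = Holds-mapTerms ρ ρ′ (substᵗ s) φ λ t p → evalᵗ-subst ρ ρ′ s t (h ∘ p)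

Holds-cong : ∀ (ρ ρ′ : Var d → ℤ) φ → (∀ {v} → v ∈ vars φ → ρ v ≡ ρ′ v) →
             Holds ρ φ → Holds ρ′ φ
Holds-cong ρ ρ′ φ h =
  -- Substituting `var` for every variable is the identity semantically, so `substᶠ var φ` links the
  -- truth of `φ` at `ρ` to its truth at `ρ′`.
  to (Holds-subst ρ ρ′ var φ λ p → trans (evalᵗ-var ρ _) (h p)) ∘
  from (Holds-subst ρ ρ var φ λ _ → evalᵗ-var ρ _)

-- Partial valuations and consistency.

infixl 5 _▷_

_▷_ : Valuation d → (Var d → ℤ) → Var d → ℤ
(σ ▷ ρ) v = fromMaybe (ρ v) (σ v)

Holds-apply : ∀ (σ : Valuation d) ρ φ → Holds ρ (apply σ φ) ⇔ Holds (σ ▷ ρ) φ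
Holds-apply σ ρ φ = Holds-subst ρ (σ ▷ ρ) (λ v → maybe con (var v) (σ v)) φ λ {v} _ → evaluated v
  where
  evaluated : ∀ v → evalᵗ ρ (maybe con (var v) (σ v)) ≡ (σ ▷ ρ) v
  evaluated v with σ v
  ... | just z  = refl
  ... | nothing = evalᵗ-var ρ v

-- The valuation `just ∘ ρ` is defined everywhere, so the domain condition of `⊨` is immediate. With
-- `consistent⁻`, this reduces satisfiability after `apply σ` to a choice of values where `σ` is
-- undefined.
consistent⁺ : ∀ (σ : Valuation d) ρ φ → Holds (σ ▷ ρ) φ → Consistent σ φ
consistent⁺ σ ρ φ h = just ∘ ρ , (λ _ → _ , refl) , from (Holds-apply σ ρ φ) h

consistent⁻ : ∀ (σ : Valuation d) φ → Consistent σ φ → ∃[ ρ ] Holds (σ ▷ ρ) φ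
consistent⁻ σ φ (θ , _ , h) = total θ , to (Holds-apply σ (total θ) φ) h

⊨-∧ : ∀ (σ : Valuation d) φ ψ → σ ⊨ φ → σ ⊨ ψ → σ ⊨ φ ∧ᶠ ψ
⊨-∧ σ φ ψ (p , h) (q , k) = (λ v∈ → [ p , q ]′ (∈-++⁻ (vars φ) v∈)) , h , k

⊨-⋀ : ∀ (σ : Valuation d) φs → All (σ ⊨_) φs → σ ⊨ ⋀ φs
⊨-⋀ σ []       []       = (λ ()) , tt
⊨-⋀ σ (φ ∷ φs) (h ∷ hs) = ⊨-∧ σ φ (⋀ φs) h (⊨-⋀ σ φs hs)

-- Fusion of term maps, and closure of literals under addition.

mapTerms-∘ : ∀ (f g : Term d → Term d) φ → mapTerms f (mapTerms g φ) ≡ mapTerms (f ∘ g) φ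
mapTerms-∘ f g (lit (cmp r t)) = refl
mapTerms-∘ f g (lit (dvd e t)) = refl
mapTerms-∘ f g ⊤ᶠ              = refl
mapTerms-∘ f g (φ ∧ᶠ ψ)        = cong₂ _∧ᶠ_ (mapTerms-∘ f g φ) (mapTerms-∘ f g ψ)
mapTerms-∘ f g (φ ∨ᶠ ψ)        = cong₂ _∨ᶠ_ (mapTerms-∘ f g φ) (mapTerms-∘ f g ψ)
mapTerms-∘ f g (¬ᶠ φ)          = cong ¬ᶠ_ (mapTerms-∘ f g φ)

-- All comparisons are with 0, and `0ℤ + 0ℤ` computes to `0ℤ`, so monotonicity of addition already
-- has the required type.
⟦⟧ᶜ-+ : ∀ r {x y} → ⟦ r ⟧ᶜ x → ⟦ r ⟧ᶜ y → ⟦ r ⟧ᶜ (x + y)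
⟦⟧ᶜ-+ le = ℤₚ.+-mono-≤
⟦⟧ᶜ-+ ge = ℤₚ.+-mono-≤
⟦⟧ᶜ-+ lt = ℤₚ.+-mono-<
⟦⟧ᶜ-+ gt = ℤₚ.+-mono-<
⟦⟧ᶜ-+ eq = cong₂ _+_

-- Comparisons and divisibility survive addition and conjunction keeps this property; disjunction
-- and negation would break it.
Holds-+ : ∀ (ρ₁ ρ₂ ρ₃ : Var d → ℤ) f {φ} → IsConjunction φ →
          (∀ t → (∀ {v} → v ∈ varsᵗ t → v ∈ vars φ) →
                 evalᵗ ρ₃ (f t) ≡ evalᵗ ρ₁ (f t) + evalᵗ ρ₂ (f t)) →
          Holds ρ₁ (mapTerms f φ) → Holds ρ₂ (mapTerms f φ) → Holds ρ₃ (mapTerms f φ)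
Holds-+ _ _ _ _ (lit (cmp r t)) h p q = subst ⟦ r ⟧ᶜ (sym (h t λ x → x)) (⟦⟧ᶜ-+ r p q)
Holds-+ _ _ _ _ (lit (dvd e t)) h p q = subst (_ ∣_) (sym (h t λ x → x)) (∣m∣n⇒∣m+n p q)
Holds-+ _ _ _ _ ⊤ᶠ h _ _ = tt
Holds-+ ρ₁ ρ₂ ρ₃ f (_∧ᶠ_ {φ = φ} c c′) h (p , p′) (q , q′) =
  Holds-+ ρ₁ ρ₂ ρ₃ f c (λ t i → h t (∈-++⁺ˡ ∘ i)) p q ,
  Holds-+ ρ₁ ρ₂ ρ₃ f c′ (λ t i → h t (∈-++⁺ʳ (vars φ) ∘ i)) p′ q′

evalᵗ-constant : ∀ (ρ : Var d → ℤ) t →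
                 evalᵗ ρ t ≡ evalᵗ ρ (lin (Term.coeffs t) 0ℤ) + Term.constant t
evalᵗ-constant ρ (lin [] c) = sym (ℤₚ.+-identityˡ c)
evalᵗ-constant ρ (lin ((a , v) ∷ as) c) =
  trans (cong (a * ρ v +_) (evalᵗ-constant ρ (lin as c)))
        (sym (ℤₚ.+-assoc (a * ρ v) _ c))

-- Evaluation of terms whose constant is multiplied by the counter.

module _ (cvp : Formula d → Valuation d → VarSet d → Formula d) (isCVP : IsCVP cvp)
         (δ : Fin d → ℕ) (δ-injective : Injective _≡_ _≡_ δ) (n : ℕ) where

  open Construction cvp δ n
  private module CVP = IsCVP isCVP

  evalᵗ-scale : ∀ ρ t → evalᵗ ρ (scaleConstant t) ≡
                evalᵗ ρ (lin (Term.coeffs t) 0ℤ) + Term.constant t * ρ (extra n)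
  evalᵗ-scale ρ (lin as c) =
    trans (evalᵗ-⊕ ρ (lin as 0ℤ) (lin ((c , extra n) ∷ []) 0ℤ))
          (cong (evalᵗ ρ (lin as 0ℤ) +_) (ℤₚ.+-identityʳ _))

  evalᵗ-scale-one : ∀ ρ t → ρ (extra n) ≡ 1ℤ → evalᵗ ρ (scaleConstant t) ≡ evalᵗ ρ t
  evalᵗ-scale-one ρ t ρn≡1 = begin
    evalᵗ ρ (scaleConstant t)  ≡⟨ evalᵗ-scale ρ t ⟩
    x + c * ρ (extra n)        ≡⟨ cong (λ z → x + c * z) ρn≡1 ⟩
    x + c * 1ℤ                 ≡⟨ cong (x +_) (ℤₚ.*-identityʳ c) ⟩
    x + c                      ≡⟨ evalᵗ-constant ρ t ⟨
    evalᵗ ρ t                  ∎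
    where
    open ≡-Reasoning
    c = Term.constant t
    x = evalᵗ ρ (lin (Term.coeffs t) 0ℤ)

  -- `scaleConstant` appends one counter entry per term, so the coefficient lists of the two sides
  -- differ and additivity holds only after evaluation.
  evalᵗ-scale-⊕ : ∀ ρ s t → evalᵗ ρ (scaleConstant (s ⊕ t)) ≡
                  evalᵗ ρ (scaleConstant s) + evalᵗ ρ (scaleConstant t)
  evalᵗ-scale-⊕ ρ s@(lin as a) t@(lin bs b) = begin
    evalᵗ ρ (scaleConstant (s ⊕ t))
      ≡⟨ evalᵗ-scale ρ (s ⊕ t) ⟩
    evalᵗ ρ (lin as 0ℤ ⊕ lin bs 0ℤ) + (a + b) * k
      ≡⟨ cong (_+ (a + b) * k) (evalᵗ-⊕ ρ (lin as 0ℤ) (lin bs 0ℤ)) ⟩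
    x + y + (a + b) * k
      ≡⟨ rearrange x y a b k ⟩
    (x + a * k) + (y + b * k)
      ≡⟨ cong₂ _+_ (evalᵗ-scale ρ s) (evalᵗ-scale ρ t) ⟨
    evalᵗ ρ (scaleConstant s) + evalᵗ ρ (scaleConstant t) ∎
    where
    open ≡-Reasoning
    k = ρ (extra n)
    x = evalᵗ ρ (lin as 0ℤ)
    y = evalᵗ ρ (lin bs 0ℤ)
    rearrange : ∀ x y a b k → x + y + (a + b) * k ≡ (x + a * k) + (y + b * k)
    rearrange = solve-∀

  evalᵗ-scale-⊙ : ∀ ρ a t → evalᵗ ρ (scaleConstant (a ⊙ t)) ≡ a * evalᵗ ρ (scaleConstant t)
  evalᵗ-scale-⊙ ρ a (lin [] c) = rearrange a c (ρ (extra n))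
    where
    rearrange : ∀ a c k → a * c * k + 0ℤ ≡ a * (c * k + 0ℤ)
    rearrange = solve-∀
  evalᵗ-scale-⊙ ρ a (lin ((b , v) ∷ bs) c) =
    trans (cong (a * b * ρ v +_) (evalᵗ-scale-⊙ ρ a (lin bs c)))
          (factor a b (ρ v) _)
    where
    factor : ∀ a b x y → a * b * x + a * y ≡ a * (b * x + y)
    factor = solve-∀

  -- Additivity passes from the substituted terms to their linear combinations. The constant `c`
  -- contributes `c` times the counter, which is additive because the counters add up; a bare `c`
  -- would not be.
  scale-subst-+ : ∀ ρ₁ ρ₂ ρ₃ s t → ρ₃ (extra n) ≡ ρ₁ (extra n) + ρ₂ (extra n) →
    (∀ {v} → v ∈ varsᵗ t → evalᵗ ρ₃ (scaleConstant (s v)) ≡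
                           evalᵗ ρ₁ (scaleConstant (s v)) + evalᵗ ρ₂ (scaleConstant (s v))) →
    evalᵗ ρ₃ (scaleConstant (substᵗ s t)) ≡
    evalᵗ ρ₁ (scaleConstant (substᵗ s t)) + evalᵗ ρ₂ (scaleConstant (substᵗ s t))
  scale-subst-+ ρ₁ ρ₂ ρ₃ s (lin [] c) hn h =
    trans (cong (λ z → c * z + 0ℤ) hn) (distrib c (ρ₁ (extra n)) (ρ₂ (extra n)))
    where
    distrib : ∀ c x y → c * (x + y) + 0ℤ ≡ (c * x + 0ℤ) + (c * y + 0ℤ)
    distrib = solve-∀
  scale-subst-+ ρ₁ ρ₂ ρ₃ s (lin ((a , v) ∷ as) c) hn h = begin
    evalᵗ ρ₃ (scaleConstant (a ⊙ s v ⊕ t))  ≡⟨ expand ρ₃ ⟩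
    a * E ρ₃ (s v) + E ρ₃ t                 ≡⟨ cong₂ (λ x y → a * x + y) (h (here refl))
                                                 (scale-subst-+ ρ₁ ρ₂ ρ₃ s (lin as c) hn (h ∘ there)) ⟩
    a * (E ρ₁ (s v) + E ρ₂ (s v)) + (E ρ₁ t + E ρ₂ t)
      ≡⟨ rearrange a (E ρ₁ (s v)) (E ρ₂ (s v)) (E ρ₁ t) (E ρ₂ t) ⟩
    (a * E ρ₁ (s v) + E ρ₁ t) + (a * E ρ₂ (s v) + E ρ₂ t)
      ≡⟨ cong₂ _+_ (expand ρ₁) (expand ρ₂) ⟨
    E ρ₁ (a ⊙ s v ⊕ t) + E ρ₂ (a ⊙ s v ⊕ t) ∎
    where
    open ≡-Reasoning
    t = substᵗ s (lin as c)
    E = λ ρ u → evalᵗ ρ (scaleConstant u)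
    expand : ∀ ρ → E ρ (a ⊙ s v ⊕ t) ≡ a * E ρ (s v) + E ρ t
    expand ρ = trans (evalᵗ-scale-⊕ ρ (a ⊙ s v) t) (cong (_+ E ρ t) (evalᵗ-scale-⊙ ρ a (s v)))
    rearrange : ∀ a x y z w → a * (x + y) + (z + w) ≡ (a * x + z) + (a * y + w)
    rearrange = solve-∀

  -- Models of the transition extended by difference variables.

  extend-δ : ∀ σ i → extend σ (extra (δ i)) ≡ just (evalᵗ (total σ) (diff i))
  extend-δ σ i with isδ? (δ i)
  ... | no ¬p           = ⊥-elim (¬p (i , refl))
  -- The search may return any index `j` with the same difference variable; injectivity of `δ`
  -- identifies it with `i`.
  ... | yes (j , δj≡δi) = cong (λ j → just (evalᵗ (total σ) (diff j))) (δ-injective δj≡δi)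

  extend-⊨-≐ : ∀ σ i → extend σ ⊨ (var (extra (δ i)) ≐ diff i)
  extend-⊨-≐ σ i = defined , (begin
    evalᵗ ρ (var (extra (δ i)) ⊖ diff i)
      ≡⟨ evalᵗ-⊕ ρ (var (extra (δ i))) (-1ℤ ⊙ diff i) ⟩
    evalᵗ ρ (var (extra (δ i))) + evalᵗ ρ (-1ℤ ⊙ diff i)
      ≡⟨ cong₂ _+_ (trans (evalᵗ-var ρ (extra (δ i))) (cong (fromMaybe 0ℤ) (extend-δ σ i)))
                   (evalᵗ-⊙ ρ -1ℤ (diff i)) ⟩
    z + -1ℤ * z
      ≡⟨ cancel z ⟩
    0ℤ ∎)
    where
    open ≡-Reasoning
    ρ = total (extend σ)
    z = evalᵗ (total σ) (diff i)
    cancel : ∀ z → z + -1ℤ * z ≡ 0ℤ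
    cancel = solve-∀
    defined : ∀ {v} → v ∈ vars (var (extra (δ i)) ≐ diff i) → v ∈dom extend σ
    defined (here refl)                 = _ , extend-δ σ i
    defined (there (here refl))         = _ , refl
    defined (there (there (here refl))) = _ , refl

  -- A transition has no extra variables, so overwriting difference variables cannot affect `τ`.
  -- This makes the properties of `cvp` available for `τ∧δ τ`.
  extend-⊨ : ∀ τ σ → IsTransition τ → σ ⊨ τ → extend σ ⊨ τ∧δ τ
  extend-⊨ τ σ (_ , no-extra) (defined , holds) =
    ⊨-∧ (extend σ) τ (⋀ φs) (defined′ , Holds-cong (total σ) (total (extend σ)) τ agree holds)
        (⊨-⋀ (extend σ) φs all)
    where
    φs = map (λ i → var (extra (δ i)) ≐ diff i) (allFin d)
    all : All (extend σ ⊨_) φs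
    all = Allₚ.map⁺ (Allₚ.tabulate⁺ (extend-⊨-≐ σ))
    defined′ : ∀ {v} → v ∈ vars τ → v ∈dom extend σ
    defined′ {pre i}   _ = _ , refl
    defined′ {post i}  _ = _ , refl
    defined′ {extra k} p = ⊥-elim (no-extra k p)
    agree : ∀ {v} → v ∈ vars τ → total σ v ≡ total (extend σ) v
    agree {pre i}   _ = refl
    agree {post i}  _ = refl
    agree {extra k} p = ⊥-elim (no-extra k p)

  -- The three properties of a transitive projection.

  tp-consistent : ∀ τ σ → IsTransition τ → σ ⊨ τ → σ (extra n) ≡ nothing →
                  Consistent σ (tp τ σ)
  tp-consistent τ σ trn m n-fresh = consistent⁺ σ witness (tp τ σ)
    ( subst ⟦ gt ⟧ᶜ (sym (trans (evalᵗ-var ρ (extra n)) ρn≡1)) (+<+ (s≤s z≤n))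
    -- At counter 1 scaling changes no value; replacing each difference variable by its difference
    -- then leads back to `τδ` at `extend σ`, where it holds by `model`.
    , from (Holds-mapTerms ρ ρ scaleConstant (τrec τ σ) λ t _ → evalᵗ-scale-one ρ t ρn≡1)
        (from (Holds-subst ρ (total (extend σ)) δ↦diff (τδ τ σ) λ {v} p →
                 δ-value v (proj₁ (CVP.variables (τ∧δ τ) (extend σ) δVars m′ p)))
           (proj₂ (CVP.model (τ∧δ τ) (extend σ) δVars m′)))
    , Holds-cong (total σ) ρ (cvp τ σ preVars)
        (pre-value ∘ proj₁ ∘ CVP.variables τ σ preVars m)
        (proj₂ (CVP.model τ σ preVars m))
    , Holds-cong (total σ) ρ (cvp τ σ postVars)
        (post-value ∘ proj₁ ∘ CVP.variables τ σ postVars m)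
        (proj₂ (CVP.model τ σ postVars m)))
    where
    m′ = extend-⊨ τ σ trn m
    -- The defaults 0 match those of total and extend on unassigned state variables.
    witness : Var d → ℤ
    witness (extra _) = 1ℤ
    witness _         = 0ℤ
    ρ = σ ▷ witness
    ρn≡1 : ρ (extra n) ≡ 1ℤ
    ρn≡1 = cong (fromMaybe 1ℤ) n-fresh
    δ-value : ∀ v → T (δVars v) → evalᵗ ρ (δ↦diff v) ≡ total (extend σ) v
    δ-value (extra k) p with isδ? k
    -- Both sides are the same difference, at valuations agreeing by computation on state variables.
    -- The case `no` would make `p` an element of the empty type.
    ... | yes _ = refl
    pre-value : ∀ {v} → T (preVars v) → total σ v ≡ ρ v
    pre-value {pre _} _ = refl
    post-value : ∀ {v} → T (postVars v) → total σ v ≡ ρ v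
    post-value {post _} _ = refl

  -- Only the three calls to `cvp` depend on the valuation, so the images lie in a product of three
  -- finite lists. For the first call, each model `θ` of `τ` enters as the model `extend θ` of
  -- `τ∧δ τ`.
  tp-finite : ∀ τ σ → IsTransition τ → σ ⊨ τ → FiniteImage (tp τ) τ
  tp-finite τ σ trn m = _ , λ θ h → ∈-cartesianProductWith⁺ combine
    (proj₂ recs (extend θ) (extend-⊨ τ θ trn h))
    (∈-cartesianProductWith⁺ _∧ᶠ_ (proj₂ pres θ h) (proj₂ posts θ h))
    where
    recs  = CVP.finite (τ∧δ τ) (extend σ) δVars (extend-⊨ τ σ trn m)
    pres  = CVP.finite τ σ preVars m
    posts = CVP.finite τ σ postVars m
    combine : Formula d → Formula d → Formula d
    combine φ ψ =
      lit (cmp gt (var (extra n))) ∧ᶠ mapTerms scaleConstant (substᶠ δ↦diff φ) ∧ᶠ ψ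

  tp-transitive : ∀ τ σ → IsTransition τ → σ ⊨ τ → Transitive (Step (tp τ σ))
  tp-transitive τ σ trn m {u} {v} {w} s₁ s₂
    with θ₁ , pos₁ , rec₁ , pre₁ , _     ← consistent⁻ [ u , v ] (tp τ σ) s₁
    with θ₂ , pos₂ , rec₂ , _    , post₂ ← consistent⁻ [ v , w ] (tp τ σ) s₂
    -- Adding the two assignments pointwise makes the counter of `ρ₃` the sum of the other two by
    -- computation, hence `refl` for the counter premise below.
    = consistent⁺ [ u , w ] (λ x → θ₁ x + θ₂ x) (tp τ σ)
        ( subst ⟦ gt ⟧ᶜ (sym (distrib (θ₁ (extra n)) (θ₂ (extra n)))) (⟦⟧ᶜ-+ gt pos₁ pos₂)
        , subst (Holds ρ₃) (sym fuse)
            (Holds-+ ρ₁ ρ₂ ρ₃ (scaleConstant ∘ substᵗ δ↦diff)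
              (CVP.conjunction (τ∧δ τ) (extend σ) δVars m′)
              (λ t p → scale-subst-+ ρ₁ ρ₂ ρ₃ δ↦diff t refl λ {x} q →
                 δ-additive x (proj₁ (CVP.variables (τ∧δ τ) (extend σ) δVars m′ (p q))))
              (subst (Holds ρ₁) fuse rec₁) (subst (Holds ρ₂) fuse rec₂))
        , Holds-cong ρ₁ ρ₃ (cvp τ σ preVars)
            (pre-value ∘ proj₁ ∘ CVP.variables τ σ preVars m) pre₁
        , Holds-cong ρ₂ ρ₃ (cvp τ σ postVars)
            (post-value ∘ proj₁ ∘ CVP.variables τ σ postVars m) post₂)
    where
    m′ = extend-⊨ τ σ trn m
    -- Views the scaled `τrec` as one term map over `τδ`, the formula for which `cvp` guarantees
    -- conjunctive shape and the admissible variables.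
    fuse = mapTerms-∘ scaleConstant (substᵗ δ↦diff) (τδ τ σ)
    ρ₁ = [ u , v ] ▷ θ₁
    ρ₂ = [ v , w ] ▷ θ₂
    ρ₃ = [ u , w ] ▷ λ x → θ₁ x + θ₂ x
    distrib : ∀ x y → 1ℤ * (x + y) + 0ℤ ≡ (1ℤ * x + 0ℤ) + (1ℤ * y + 0ℤ)
    distrib = solve-∀
    δ-additive : ∀ x → T (δVars x) → let t = scaleConstant (δ↦diff x) in
                 evalᵗ ρ₃ t ≡ evalᵗ ρ₁ t + evalᵗ ρ₂ t
    δ-additive (extra k) p with isδ? k
    -- This is w - u = (v - u) + (w - v) in coordinate `i`. The products with `0ℤ` are the zero
    -- constant of `diff i` multiplied by the counters.
    ... | yes (i , _) =
      telescope (lookup u i) (lookup v i) (lookup w i) (θ₁ (extra n)) (θ₂ (extra n))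
      where
      telescope : ∀ a b c k l →
        1ℤ * c + (-1ℤ * a + (0ℤ * (k + l) + 0ℤ)) ≡
        (1ℤ * b + (-1ℤ * a + (0ℤ * k + 0ℤ))) + (1ℤ * c + (-1ℤ * b + (0ℤ * l + 0ℤ)))
      telescope = solve-∀
    pre-value : ∀ {x} → T (preVars x) → ρ₁ x ≡ ρ₃ x
    pre-value {pre _} _ = refl
    post-value : ∀ {x} → T (postVars x) → ρ₂ x ≡ ρ₃ x
    post-value {post _} _ = refl

theorem2 : ∀ {d : ℕ} (cvp : Formula d → Valuation d → VarSet d → Formula d) →
    IsCVP cvp →
    (δ : Fin d → ℕ) → Injective _≡_ _≡_ δ →
    (n : ℕ) → (∀ i → δ i ≢ n) →
    IsTransitiveProjection (Construction.tp cvp δ n)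
theorem2 cvp isCVP δ δ-injective n _ = record
  { consistent = λ τ trn σ m fresh →
      -- The first conjunct is n > 0, so `extra n` heads the variable list of `tp τ σ`.
      tp-consistent cvp isCVP δ δ-injective n τ σ trn m (fresh n (here refl))
  ; finite     = λ τ trn σ m → tp-finite cvp isCVP δ δ-injective n τ σ trn m
  ; transitive = λ τ trn σ m → tp-transitive cvp isCVP δ δ-injective n τ σ trn m
  }
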